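{- Let $a,b,m,n$ be positive integers. Then $$\frac{abm}{(a+b)(m+n)}\binom{am+bm}{am}\binom{an+bn}{an}=\frac{am}{m+n}\binom{am+bm-1}{am}\binom{an+bn}{an}\in\mathbb{Z}.$$
   Context: $\mathbb{Z}$ denotes the set of integers. -}

module Defs where

open import Data.Nat.Base using (suc; _+_; NonZero)

m+n≢0 : ∀ m n → .{{_ : NonZero m}} → NonZero (m + n)
m+n≢0 (suc _) _ = _

{-# OPTIONS --safe #-}

-- Put N = a + b, A_m = C(Nm−1, am−1) and B_m = C(Nm−1, am).  Since
-- a B_m = b A_m and b C(Nn, an) = N B_n, the second expression of the theorem
-- equals Nm A_m B_n / (m + n).  More generally, Nm C(Nm−1, h) C(Nn−1, j) is
-- divisible by m + n whenever h + 1 + j = a(m + n): for j = 0 it equals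
-- (h + 1) C(Nm, h + 1), and passing from (h + 1, j) to (h, j + 1) changes it by
-- a multiple of m + n.

module Submission where

open import Defs
open import Data.Nat using (ℕ; zero; suc; _+_; _*_; _∸_; NonZero)
open import Data.Nat.Properties
  using (m*n≢0; +-suc; +-identityʳ; *-comm; *-identityˡ; *-identityʳ;
         *-cancelʳ-≡; *-cancelˡ-≡; +-cancelˡ-≡; *-distribˡ-+)
open import Data.Nat.Combinatorics using (_C_; nC1≡n; nCk+nC[k+1]≡[n+1]C[k+1])
open import Data.Nat.Divisibility
  using (_∣_; divides; ∣m⇒∣m*n; ∣m∣n⇒∣m+n; ∣m+n∣m⇒∣n)
open import Data.Nat.Tactic.RingSolver using (solve-∀)
open import Data.Integer as ℤ using (ℤ; +_)
import Data.Integer.Properties as ℤ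
open import Data.Rational as ℚ using (_/_)
import Data.Rational.Properties as ℚ
import Data.Rational.Unnormalised as ℚᵘ
import Data.Rational.Unnormalised.Properties as ℚᵘ
open import Data.Rational.Literals using (fromℤ)
open import Data.Product using (_×_; _,_; Σ-syntax)
open import Relation.Binary.PropositionalEquality
  using (_≡_; refl; sym; trans; cong; cong₂; subst; module ≡-Reasoning)

open ≡-Reasoning

[1+k]*[1+n]C[1+k]≡[1+n]*nCk : ∀ n k → suc k * (suc n C suc k) ≡ suc n * (n C k)
[1+k]*[1+n]C[1+k]≡[1+n]*nCk zero zero = refl
[1+k]*[1+n]C[1+k]≡[1+n]*nCk zero (suc k) = *-comm (suc (suc k)) 0
[1+k]*[1+n]C[1+k]≡[1+n]*nCk (suc n) zero = begin
  1 * (suc (suc n) C 1)  ≡⟨ *-identityˡ _ ⟩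
  suc (suc n) C 1        ≡⟨ nC1≡n (suc (suc n)) ⟩
  suc (suc n)            ≡⟨ *-identityʳ _ ⟨
  suc (suc n) * 1        ∎
[1+k]*[1+n]C[1+k]≡[1+n]*nCk (suc n) (suc k) = begin
  suc (suc k) * (suc (suc n) C suc (suc k))
    ≡⟨ cong (suc (suc k) *_) (nCk+nC[k+1]≡[n+1]C[k+1] (suc n) (suc k)) ⟨
  suc (suc k) * (x + y)
    -- One `x` is set aside so that the coefficients left over are those of the two induction
    -- hypotheses. Their results recombine by Pascal's rule into `suc n * x`.
    ≡⟨ split k x y ⟩
  x + (suc k * x + suc (suc k) * y)
    ≡⟨ cong (λ t → x + t) (cong₂ _+_ ([1+k]*[1+n]C[1+k]≡[1+n]*nCk n k)
                            ([1+k]*[1+n]C[1+k]≡[1+n]*nCk n (suc k))) ⟩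
  x + (suc n * (n C k) + suc n * (n C suc k))
    ≡⟨ cong (λ t → x + t) (*-distribˡ-+ (suc n) (n C k) (n C suc k)) ⟨
  x + suc n * (n C k + n C suc k)
    ≡⟨ cong (λ t → x + suc n * t) (nCk+nC[k+1]≡[n+1]C[k+1] n k) ⟩
  suc (suc n) * x ∎
  where
  x = suc n C suc k
  y = suc n C suc (suc k)
  split : ∀ k x y → suc (suc k) * (x + y) ≡ x + (suc k * x + suc (suc k) * y)
  split = solve-∀

-- This is the passage between `(suc h , j)` and `(h , suc j)`. The correction terms sit on opposite
-- sides to avoid subtraction. Adding the multiple of `suc p + suc q` completes the products to
-- `A + B` and `u + v`. Pascal's rule and absorption then turn them into a multiple of
-- `suc h + suc j`.
exchange : ∀ p q h j →
  (suc p + suc q) * ((q C j) * (suc p C suc h)) + suc p * (p C h) * (q C suc j) ≡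
  (suc h + suc j) * ((suc q C suc j) * (suc p C suc h)) + suc p * (p C suc h) * (q C j)
exchange p q h j = begin
  (suc p + suc q) * (u * w) + suc p * A * v
    ≡⟨ cong (λ w → (suc p + suc q) * (u * w) + suc p * A * v) pascal-w ⟨
  (suc p + suc q) * (u * (A + B)) + suc p * A * v
    ≡⟨ expand (suc p) (suc q) A B u v ⟩
  suc p * A * (u + v) + suc q * u * (A + B) + suc p * B * u
    ≡⟨ cong (_+ suc p * B * u) (cong₂ _+_ (cong₂ _*_ (sym ([1+k]*[1+n]C[1+k]≡[1+n]*nCk p h)) pascal-z)
                                    (cong₂ _*_ (sym ([1+k]*[1+n]C[1+k]≡[1+n]*nCk q j)) pascal-w)) ⟩
  suc h * w * z + suc j * z * w + suc p * B * u
    ≡⟨ cong (_+ suc p * B * u) (collect (suc h) (suc j) z w) ⟩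
  (suc h + suc j) * (z * w) + suc p * B * u ∎
  where
  A = p C h
  B = p C suc h
  u = q C j
  v = q C suc j
  w = suc p C suc h
  z = suc q C suc j
  pascal-w : A + B ≡ w
  pascal-w = nCk+nC[k+1]≡[n+1]C[k+1] p h
  pascal-z : u + v ≡ z
  pascal-z = nCk+nC[k+1]≡[n+1]C[k+1] q j
  expand : ∀ s t A B u v → (s + t) * (u * (A + B)) + s * A * v ≡ s * A * (u + v) + t * u * (A + B) + s * B * u
  expand = solve-∀
  collect : ∀ h j z w → h * w * z + j * z * w ≡ (h + j) * (z * w)
  collect = solve-∀

-- Induction on `j` while `h` grows, so that `suc h + j` stays fixed. At `j = 0` the factor `q C 0`
-- is 1 and absorption exposes the factor `suc h`.
∣[1+p]*pCh*qCj : ∀ {d} p q h j → d ∣ suc p + suc q → d ∣ suc h + j → d ∣ suc p * (p C h) * (q C j)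
∣[1+p]*pCh*qCj {d} p q h zero _ d∣h+j =
  subst (d ∣_) (begin
    (suc h + 0) * (suc p C suc h)  ≡⟨ cong (_* (suc p C suc h)) (+-identityʳ (suc h)) ⟩
    suc h * (suc p C suc h)        ≡⟨ [1+k]*[1+n]C[1+k]≡[1+n]*nCk p h ⟩
    suc p * (p C h)                ≡⟨ *-identityʳ _ ⟨
    suc p * (p C h) * 1            ∎)
    (∣m⇒∣m*n (suc p C suc h) d∣h+j)
∣[1+p]*pCh*qCj {d} p q h (suc j) d∣p+q d∣h+j =
  -- The goal is the second summand on the left of `exchange`. Its first summand is a multiple of
  -- `suc p + suc q`, and `d` divides both summands on the right.
  ∣m+n∣m⇒∣n
    (subst (d ∣_) (sym (exchange p q h j))
      (∣m∣n⇒∣m+n (∣m⇒∣m*n _ d∣h+j)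
        (∣[1+p]*pCh*qCj p q (suc h) j d∣p+q (subst (d ∣_) (+-suc (suc h) j) d∣h+j))))
    (∣m⇒∣m*n _ d∣p+q)

module _ (a b n : ℕ) .{{_ : NonZero a}} .{{_ : NonZero n}} where

  private
    w A B : ℕ
    w = (a * n + b * n) C (a * n)
    A = (a * n + b * n ∸ 1) C (a * n ∸ 1)
    B = (a * n + b * n ∸ 1) C (a * n)

  a*C≡[a+b]*C[∸1,∸1] : a * w ≡ (a + b) * A
  a*C≡[a+b]*C[∸1,∸1] = *-cancelʳ-≡ _ _ n (begin
    a * w * n                    ≡⟨ swap a w n ⟩
    a * n * w                    ≡⟨ absorb a b n ⟩
    (a * n + b * n) * A          ≡⟨ factor a b n A ⟩
    (a + b) * A * n              ∎)
    where
    swap : ∀ x y z → x * y * z ≡ x * z * y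
    swap = solve-∀
    factor : ∀ a b n A → (a * n + b * n) * A ≡ (a + b) * A * n
    factor = solve-∀
    absorb : ∀ a b n .{{_ : NonZero a}} .{{_ : NonZero n}} →
      a * n * ((a * n + b * n) C (a * n)) ≡ (a * n + b * n) * ((a * n + b * n ∸ 1) C (a * n ∸ 1))
    -- Once `a` and `n` are successors, both `∸ 1` compute and this is absorption itself.
    absorb (suc a) b (suc n) = [1+k]*[1+n]C[1+k]≡[1+n]*nCk (n + a * suc n + b * suc n) (n + a * suc n)

  -- Pascal's rule multiplied by `a + b`, with the preceding identity subtracted.
  b*C≡[a+b]*C[∸1] : b * w ≡ (a + b) * B
  b*C≡[a+b]*C[∸1] = +-cancelˡ-≡ (a * w) _ _ (begin
    a * w + b * w                ≡⟨ factor a b w ⟩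
    (a + b) * w                  ≡⟨ cong ((a + b) *_) (pascal a b n) ⟨
    (a + b) * (A + B)            ≡⟨ *-distribˡ-+ (a + b) A B ⟩
    (a + b) * A + (a + b) * B    ≡⟨ cong (_+ (a + b) * B) a*C≡[a+b]*C[∸1,∸1] ⟨
    a * w + (a + b) * B          ∎)
    where
    factor : ∀ a b w → a * w + b * w ≡ (a + b) * w
    factor = solve-∀
    pascal : ∀ a b n .{{_ : NonZero a}} .{{_ : NonZero n}} →
      (a * n + b * n ∸ 1) C (a * n ∸ 1) + (a * n + b * n ∸ 1) C (a * n) ≡ (a * n + b * n) C (a * n)
    pascal (suc a) b (suc n) = nCk+nC[k+1]≡[n+1]C[k+1] (n + a * suc n + b * suc n) (n + a * suc n)

  -- After multiplication by `a + b`, both sides become `a * b * w`.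
  a*C[∸1]≡b*C[∸1,∸1] : a * B ≡ b * A
  a*C[∸1]≡b*C[∸1,∸1] = *-cancelˡ-≡ _ _ (a + b) {{m+n≢0 a b}} (begin
    (a + b) * (a * B)    ≡⟨ swap (a + b) a B ⟩
    a * ((a + b) * B)    ≡⟨ cong (a *_) b*C≡[a+b]*C[∸1] ⟨
    a * (b * w)          ≡⟨ swap a b w ⟩
    b * (a * w)          ≡⟨ cong (b *_) a*C≡[a+b]*C[∸1,∸1] ⟩
    b * ((a + b) * A)    ≡⟨ swap b (a + b) A ⟩
    (a + b) * (b * A)    ∎)
    where
    swap : ∀ x y z → x * (y * z) ≡ y * (x * z)
    swap = solve-∀

m+n∣[a+b]m*C*C : ∀ a b m n .{{_ : NonZero a}} .{{_ : NonZero m}} .{{_ : NonZero n}} →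
  m + n ∣ (a * m + b * m) * ((a * m + b * m ∸ 1) C (a * m ∸ 1)) * ((a * n + b * n ∸ 1) C (a * n))
m+n∣[a+b]m*C*C a@(suc _) b m@(suc _) n@(suc _) =
  -- Here `suc p`, `suc q` and `suc h` are `a * m + b * m`, `a * n + b * n` and `a * m`. The
  -- successor patterns let them be matched. The two sums are then `(a + b) * (m + n)` and
  -- `a * (m + n)`.
  ∣[1+p]*pCh*qCj _ _ _ (a * n)
    (divides (a + b) (factor a b m n))
    (divides a (sym (*-distribˡ-+ a m n)))
  where
  factor : ∀ a b m n → (a * m + b * m) + (a * n + b * n) ≡ (a + b) * (m + n)
  factor = solve-∀

m+n∣a*m*C*C : ∀ a b m n .{{_ : NonZero a}} .{{_ : NonZero m}} .{{_ : NonZero n}} →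
  m + n ∣ a * m * ((a * m + b * m ∸ 1) C (a * m)) * ((a * n + b * n) C (a * n))
m+n∣a*m*C*C a b m n = subst (m + n ∣_) (sym (begin
  a * m * Bₘ * wₙ                  ≡⟨ regroup₁ a m Bₘ wₙ ⟩
  -- The factor `b` produced here is the one that `wₙ` needs in order to become `(a + b) * Bₙ`.
  a * Bₘ * (m * wₙ)                ≡⟨ cong (_* (m * wₙ)) (a*C[∸1]≡b*C[∸1,∸1] a b m) ⟩
  b * Aₘ * (m * wₙ)                ≡⟨ regroup₂ b Aₘ m wₙ ⟩
  m * Aₘ * (b * wₙ)                ≡⟨ cong (m * Aₘ *_) (b*C≡[a+b]*C[∸1] a b n) ⟩
  m * Aₘ * ((a + b) * Bₙ)          ≡⟨ regroup₃ a b m Aₘ Bₙ ⟩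
  (a * m + b * m) * Aₘ * Bₙ        ∎))
  (m+n∣[a+b]m*C*C a b m n)
  where
  Aₘ = (a * m + b * m ∸ 1) C (a * m ∸ 1)
  Bₘ = (a * m + b * m ∸ 1) C (a * m)
  Bₙ = (a * n + b * n ∸ 1) C (a * n)
  wₙ = (a * n + b * n) C (a * n)
  regroup₁ : ∀ a m B w → a * m * B * w ≡ a * B * (m * w)
  regroup₁ = solve-∀
  regroup₂ : ∀ b A m w → b * A * (m * w) ≡ m * A * (b * w)
  regroup₂ = solve-∀
  regroup₃ : ∀ a b m A B → m * A * ((a + b) * B) ≡ (a * m + b * m) * A * B
  regroup₃ = solve-∀

-- Checked on unnormalised fractions, where no common factors are cancelled and the two sides differ
-- only by the denominators `d * 1` and `d`.
/*fromℤ : ∀ i d .{{_ : NonZero d}} x → (i / d) ℚ.* fromℤ x ≡ (i ℤ.* x) / d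
/*fromℤ i d@(suc d-1) x = ℚ.toℚᵘ-injective (R.begin
  ℚ.toℚᵘ ((i / d) ℚ.* fromℤ x)             R.≈⟨ ℚ.toℚᵘ-homo-* (i / d) (fromℤ x) ⟩
  ℚ.toℚᵘ (i / d) ℚᵘ.* ℚᵘ.mkℚᵘ x 0          R.≈⟨ ℚᵘ.*-congʳ (ℚ.toℚᵘ-fromℚᵘ (ℚᵘ.mkℚᵘ i d-1)) ⟩
  ℚᵘ.mkℚᵘ i d-1 ℚᵘ.* ℚᵘ.mkℚᵘ x 0           R.≈⟨ ℚᵘ.*≡* (cong (λ e → i ℤ.* x ℤ.* + e) (sym (*-identityʳ d))) ⟩
  ℚᵘ.mkℚᵘ (i ℤ.* x) d-1                    R.≈⟨ ℚ.toℚᵘ-fromℚᵘ (ℚᵘ.mkℚᵘ (i ℤ.* x) d-1) ⟨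
  ℚ.toℚᵘ ((i ℤ.* x) / d)                   R.∎)
  where
  import Relation.Binary.Reasoning.Setoid ℚᵘ.≃-setoid as R

/*fromℤ*fromℤ : ∀ s d .{{_ : NonZero d}} x y →
  (+ s / d) ℚ.* fromℤ (+ x) ℚ.* fromℤ (+ y) ≡ + (s * x * y) / d
/*fromℤ*fromℤ s d x y = begin
  (+ s / d) ℚ.* fromℤ (+ x) ℚ.* fromℤ (+ y)  ≡⟨ cong (ℚ._* fromℤ (+ y)) (/*fromℤ (+ s) d (+ x)) ⟩
  ((+ s ℤ.* + x) / d) ℚ.* fromℤ (+ y)        ≡⟨ /*fromℤ (+ s ℤ.* + x) d (+ y) ⟩
  (+ s ℤ.* + x ℤ.* + y) / d                  ≡⟨ cong (λ i → (i ℤ.* + y) / d) (ℤ.pos-* s x) ⟨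
  (+ (s * x) ℤ.* + y) / d                    ≡⟨ cong (_/ d) (ℤ.pos-* (s * x) y) ⟨
  + (s * x * y) / d                          ∎

-- Cross-multiplication is the equivalence of unnormalised fractions, which normalisation turns into
-- equality.
*≡*⇒/≡/ : ∀ s t d e .{{_ : NonZero d}} .{{_ : NonZero e}} → s * e ≡ t * d → + s / d ≡ + t / e
*≡*⇒/≡/ s t d@(suc d-1) e@(suc e-1) eq =
  ℚ.fromℚᵘ-cong {ℚᵘ.mkℚᵘ (+ s) d-1} {ℚᵘ.mkℚᵘ (+ t) e-1}
    (ℚᵘ.*≡* (trans (sym (ℤ.pos-* s e)) (trans (cong +_ eq) (ℤ.pos-* t d))))

∣⇒/≡fromℤ : ∀ {s d} .{{_ : NonZero d}} → d ∣ s → Σ[ k ∈ ℤ ] + s / d ≡ fromℤ k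
∣⇒/≡fromℤ {s} {d} (divides k eq) =
  -- The quotient `k` is the integer sought: `s / d` equals `k / 1`, which is the normal form of
  -- `fromℤ (+ k)`.
  + k , trans (*≡*⇒/≡/ s k d 1 (trans (*-identityʳ s) eq)) (ℚ.fromℚᵘ-toℚᵘ (fromℤ (+ k)))

theorem1p4 : (a b m n : ℕ) → .{{_ : NonZero a}} → .{{_ : NonZero b}} → .{{_ : NonZero m}} → .{{_ : NonZero n}} →
    let
      instance
        a+b≢0 = m+n≢0 a b
        m+n≢0′ = m+n≢0 m n
        prod≢0 = m*n≢0 (a + b) (m + n)
      lhs = (+ (a * b * m) / ((a + b) * (m + n)))
              ℚ.* fromℤ (+ ((a * m + b * m) C (a * m)))
              ℚ.* fromℤ (+ ((a * n + b * n) C (a * n)))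
      rhs = (+ (a * m) / (m + n))
              ℚ.* fromℤ (+ ((a * m + b * m ∸ 1) C (a * m)))
              ℚ.* fromℤ (+ ((a * n + b * n) C (a * n)))
    in (lhs ≡ rhs) × (Σ[ k ∈ ℤ ] rhs ≡ fromℤ k)
theorem1p4 a b m n =
  (begin
    (+ (a * b * m) / ((a + b) * (m + n))) ℚ.* fromℤ (+ wₘ) ℚ.* fromℤ (+ wₙ)
      ≡⟨ /*fromℤ*fromℤ (a * b * m) ((a + b) * (m + n)) wₘ wₙ ⟩
    + (a * b * m * wₘ * wₙ) / ((a + b) * (m + n))
      ≡⟨ *≡*⇒/≡/ (a * b * m * wₘ * wₙ) (a * m * Bₘ * wₙ) ((a + b) * (m + n)) (m + n) cross ⟩
    + (a * m * Bₘ * wₙ) / (m + n)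
      ≡⟨ rhs≡/ ⟨
    (+ (a * m) / (m + n)) ℚ.* fromℤ (+ Bₘ) ℚ.* fromℤ (+ wₙ) ∎) ,
  (let k , eq = ∣⇒/≡fromℤ (m+n∣a*m*C*C a b m n) in k , trans rhs≡/ eq)
  where
  instance
    _ = m+n≢0 a b
    _ = m+n≢0 m n
    _ = m*n≢0 (a + b) (m + n)
  wₘ = (a * m + b * m) C (a * m)
  wₙ = (a * n + b * n) C (a * n)
  Bₘ = (a * m + b * m ∸ 1) C (a * m)
  rhs≡/ : (+ (a * m) / (m + n)) ℚ.* fromℤ (+ Bₘ) ℚ.* fromℤ (+ wₙ) ≡ + (a * m * Bₘ * wₙ) / (m + n)
  rhs≡/ = /*fromℤ*fromℤ (a * m) (m + n) Bₘ wₙ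
  regroup₁ : ∀ a b m n w w′ → a * b * m * w * w′ * (m + n) ≡ b * w * (a * m * w′ * (m + n))
  regroup₁ = solve-∀
  regroup₂ : ∀ a m n N B w′ → N * B * (a * m * w′ * (m + n)) ≡ a * m * B * w′ * (N * (m + n))
  regroup₂ = solve-∀
  cross : a * b * m * wₘ * wₙ * (m + n) ≡ a * m * Bₘ * wₙ * ((a + b) * (m + n))
  cross = begin
    a * b * m * wₘ * wₙ * (m + n)               ≡⟨ regroup₁ a b m n wₘ wₙ ⟩
    -- Replacing `b * wₘ` by `(a + b) * Bₘ` is the whole content of the first equality; the rest is
    -- rearrangement.
    b * wₘ * (a * m * wₙ * (m + n))             ≡⟨ cong (_* (a * m * wₙ * (m + n))) (b*C≡[a+b]*C[∸1] a b m) ⟩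
    (a + b) * Bₘ * (a * m * wₙ * (m + n))       ≡⟨ regroup₂ a m n (a + b) Bₘ wₙ ⟩
    a * m * Bₘ * wₙ * ((a + b) * (m + n))       ∎
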